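{- For every $n\ge 1$, the poset $(\mathcal{S}_{2n}, \leq_{\mathcal{S}})$ of Schröder paths of length $2n$ has exactly $2^n$ connected components.
   Context: A Schröder path is a non-empty lattice path in $\mathbb{Z}^2$ starting at $(0,0)$, ending on the diagonal $y=x$, staying weakly above the diagonal, with steps $N=(0,1)$, $E=(1,0)$, $D=(1,1)$, where the length counts each $N$ and each $E$ step as $1$ and each $D$ step as $2$. $\mathcal{S}_{2n}$ is the set of Schröder paths of length $2n$ (equivalently, those ending at $(n,n)$). Order: a valley of a path $P$ is a lattice point $v$ on $P$ preceded by an $E$ step and followed by an $N$ or $D$ step. Given a valley $v$ of $P$, let $w$ be the next lattice point on $P$ (end point of a step) after $v$ with the same horizontal distance to the diagonal as $v$ (the horizontal distance of $(a,b)$ is $b-a$). Exchanging the sub-path of $P$ between $v$ and $w$ with the $E$ step just before $v$ gives a Schröder path $Q$ of the same length; one says $Q$ covers $P$. The order $\leq_{\mathcal{S}}$ on $\mathcal{S}_{2n}$ is the reflexive transitive closure of this covering relation. Connected components of a poset are those of its Hasse diagram. -}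

module Defs where

open import Data.Integer as ℤ using (ℤ; 0ℤ; 1ℤ)
open import Data.List using (List; []; _∷_; _++_; foldl; map)
open import Data.List.Relation.Unary.All using (All)
open import Data.Nat using (ℕ; suc; _+_; _*_; _<_; _≤_)
open import Data.Nat.ListAction using (sum)
open import Data.Nat.Properties
  using (<⇒≤; ≤-trans; ≤-reflexive; <-≤-trans; <-irrefl; ≤-refl; n≤1+n;
         +-mono-≤; +-mono-<-≤; +-mono-≤-<)
open import Data.Product using (_×_; _,_; ∃-syntax)
open import Level using (Level; _⊔_)
open import Relation.Binary.Bundles using (Poset; Setoid)
open import Relation.Binary.Core using (Rel)
open import Relation.Binary.Construct.Closure.ReflexiveTransitive
  using (Star; ε; _◅_; _◅◅_)
import Relation.Binary.Construct.Closure.Equivalence as EqClosure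
import Relation.Binary.Properties.Poset as PosetProperties
open import Relation.Binary.PropositionalEquality
  using (_≡_; _≢_; refl; cong; subst₂; sym; isEquivalence)
open import Relation.Nullary using (¬_; contradiction)

------------------------------------------------------------------------
-- Connected components of the Hasse diagram of a poset

module _ {c ℓ₁ ℓ₂ : Level} (P : Poset c ℓ₁ ℓ₂) where
  open Poset P using (Carrier)
  open PosetProperties P using () renaming (_<_ to _≺_)

  HasseEdge : Rel Carrier (c ⊔ ℓ₁ ⊔ ℓ₂)
  HasseEdge x y = x ≺ y × ¬ (∃[ z ] (x ≺ z × z ≺ y))

  -- Two elements are equal in this setoid when they are joined by a
  -- finite undirected walk in the Hasse diagram.  Walks of length zero
  -- join only propositionally equal elements, so this is meant for
  -- posets whose underlying equality is _≡_.
  components : Setoid c (c ⊔ ℓ₁ ⊔ ℓ₂)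
  components = EqClosure.setoid HasseEdge

------------------------------------------------------------------------
-- Lattice paths

data Step : Set where
  N E D : Step

Point : Set
Point = ℤ × ℤ

origin : Point
origin = 0ℤ , 0ℤ

move : Point → Step → Point
move (x , y) N = x , 1ℤ ℤ.+ y
move (x , y) E = 1ℤ ℤ.+ x , y
move (x , y) D = 1ℤ ℤ.+ x , 1ℤ ℤ.+ y

endpoint : Point → List Step → Point
endpoint = foldl move

-- All lattice points visited, both ends included.
points : Point → List Step → List Point
points p []       = p ∷ []
points p (s ∷ ss) = p ∷ points (move p s) ss

stepLength : Step → ℕ
stepLength N = 1
stepLength E = 1
stepLength D = 2

pathLength : List Step → ℕ
pathLength ss = sum (map stepLength ss)

OnDiagonal : Point → Set
OnDiagonal (x , y) = y ≡ x

WeaklyAboveDiagonal : Point → Set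
WeaklyAboveDiagonal (x , y) = x ℤ.≤ y

horizontalDistance : Point → ℤ
horizontalDistance (x , y) = y ℤ.- x

------------------------------------------------------------------------
-- Schröder paths

record IsSchröderPath (ss : List Step) : Set where
  field
    nonEmpty       : ss ≢ []
    endsOnDiagonal : OnDiagonal (endpoint origin ss)
    staysAbove     : All WeaklyAboveDiagonal (points origin ss)

-- `𝒮 n` is the set of Schröder paths of length 2n.  The proof fields
-- are propositionally unique, so _≡_ on `𝒮 n` is equality of step
-- sequences.
record 𝒮 (n : ℕ) : Set where
  field
    steps      : List Step
    isSchröder : IsSchröderPath steps
    length≡2n  : pathLength steps ≡ 2 * n

open 𝒮 public

data StartsWithNorD : List Step → Set where
  startsN : ∀ {ss} → StartsWithNorD (N ∷ ss)
  startsD : ∀ {ss} → StartsWithNorD (D ∷ ss)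

-- For non-empty `u`: walking along `u` from `v` ends at the first point
-- after `v` with the same horizontal distance as `v`.
record FirstReturn (v : Point) (u : List Step) : Set where
  field
    returns     : horizontalDistance (endpoint v u) ≡ horizontalDistance v
    noneEarlier : ∀ u₁ u₂ → u₁ ≢ [] → u₂ ≢ [] → u ≡ u₁ ++ u₂ →
                  horizontalDistance (endpoint v u₁) ≢ horizontalDistance v

-- `P ⊲ Q`: Q arises from P by choosing a valley v of P and exchanging
-- the E step before v with the sub-path of P from v to w.
record _⊲_ {n : ℕ} (P Q : 𝒮 n) : Set where
  field
    before subpath after : List Step

  v : Point
  v = endpoint origin (before ++ E ∷ [])

  field
    P-steps     : steps P ≡ before ++ (E ∷ []) ++ subpath ++ after
    valley      : StartsWithNorD subpath
    firstReturn : FirstReturn v subpath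
    Q-steps     : steps Q ≡ before ++ subpath ++ (E ∷ []) ++ after

infix 4 _⊲_ _≤ₛ_

_≤ₛ_ : ∀ {n} → Rel (𝒮 n) _
_≤ₛ_ = Star _⊲_

------------------------------------------------------------------------
-- Antisymmetry of _≤ₛ_: the number of pairs consisting of an N or D step
-- and a later E step strictly increases along _⊲_.

#E : List Step → ℕ
#E []       = 0
#E (N ∷ ss) = #E ss
#E (D ∷ ss) = #E ss
#E (E ∷ ss) = suc (#E ss)

rank : List Step → ℕ
rank []       = 0
rank (N ∷ ss) = #E ss + rank ss
rank (D ∷ ss) = #E ss + rank ss
rank (E ∷ ss) = rank ss

#E-insert : ∀ u t → #E (u ++ E ∷ t) ≡ suc (#E (u ++ t))
#E-insert []      t = refl
#E-insert (N ∷ u) t = #E-insert u t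
#E-insert (D ∷ u) t = #E-insert u t
#E-insert (E ∷ u) t = cong suc (#E-insert u t)

#E-≤-insert : ∀ u t → #E (u ++ t) ≤ #E (u ++ E ∷ t)
#E-≤-insert u t = ≤-trans (n≤1+n _) (≤-reflexive (sym (#E-insert u t)))

#E-<-insert : ∀ u t → #E (u ++ t) < #E (u ++ E ∷ t)
#E-<-insert u t = ≤-reflexive (sym (#E-insert u t))

rank-≤-insert : ∀ u t → rank (u ++ t) ≤ rank (u ++ E ∷ t)
rank-≤-insert []      t = ≤-refl
rank-≤-insert (N ∷ u) t = +-mono-≤ (#E-≤-insert u t) (rank-≤-insert u t)
rank-≤-insert (D ∷ u) t = +-mono-≤ (#E-≤-insert u t) (rank-≤-insert u t)
rank-≤-insert (E ∷ u) t = rank-≤-insert u t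

rank-<-insert : ∀ {u} t → StartsWithNorD u →
                rank (u ++ t) < rank (u ++ E ∷ t)
rank-<-insert {N ∷ u} t startsN =
  +-mono-<-≤ (#E-<-insert u t) (rank-≤-insert u t)
rank-<-insert {D ∷ u} t startsD =
  +-mono-<-≤ (#E-<-insert u t) (rank-≤-insert u t)

#E-prepend : ∀ p {a b} → #E a ≡ #E b → #E (p ++ a) ≡ #E (p ++ b)
#E-prepend []      eq = eq
#E-prepend (N ∷ p) eq = #E-prepend p eq
#E-prepend (D ∷ p) eq = #E-prepend p eq
#E-prepend (E ∷ p) eq = cong suc (#E-prepend p eq)

rank-prepend : ∀ p {a b} → #E a ≡ #E b → rank a < rank b →
               rank (p ++ a) < rank (p ++ b)
rank-prepend []      eq lt = lt
rank-prepend (N ∷ p) eq lt =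
  +-mono-≤-< (≤-reflexive (#E-prepend p eq)) (rank-prepend p eq lt)
rank-prepend (D ∷ p) eq lt =
  +-mono-≤-< (≤-reflexive (#E-prepend p eq)) (rank-prepend p eq lt)
rank-prepend (E ∷ p) eq lt = rank-prepend p eq lt

⊲⇒rank< : ∀ {n} {P Q : 𝒮 n} → P ⊲ Q → rank (steps P) < rank (steps Q)
⊲⇒rank< c = subst₂ (λ s t → rank s < rank t) (sym P-steps) (sym Q-steps)
  (rank-prepend before (sym (#E-insert subpath after))
    (rank-<-insert after valley))
  where open _⊲_ c

≤ₛ⇒rank≤ : ∀ {n} {P Q : 𝒮 n} → P ≤ₛ Q → rank (steps P) ≤ rank (steps Q)
≤ₛ⇒rank≤ ε        = ≤-refl
≤ₛ⇒rank≤ (c ◅ cs) = ≤-trans (<⇒≤ (⊲⇒rank< c)) (≤ₛ⇒rank≤ cs)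

≤ₛ-antisym : ∀ {n} {P Q : 𝒮 n} → P ≤ₛ Q → Q ≤ₛ P → P ≡ Q
≤ₛ-antisym ε        _  = refl
≤ₛ-antisym (c ◅ cs) ds =
  contradiction (<-≤-trans (⊲⇒rank< c) (≤ₛ⇒rank≤ (cs ◅◅ ds))) (<-irrefl refl)

𝒮-poset : ℕ → Poset _ _ _
𝒮-poset n = record
  { Carrier        = 𝒮 n
  ; _≈_            = _≡_
  ; _≤_            = _≤ₛ_
  ; isPartialOrder = record
    { isPreorder = record
      { isEquivalence = isEquivalence
      ; reflexive     = λ { refl → ε }
      ; trans         = _◅◅_
      }
    ; antisym    = ≤ₛ-antisym
    }
  }

{-# OPTIONS --safe #-}
-- Deleting the E steps of a path leaves a word of n letters N and D, which a
-- covering step does not change.  Conversely, replacing a factor NEE by ENE, or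
-- DE by ED, is the inverse of a covering step that raises the rank by exactly
-- one, hence it follows an edge of the Hasse diagram.  A path in which neither
-- replacement is possible is a concatenation of factors NE and D: it has no E
-- step at height 0 and at most one E step after each N step, so, as it ends on
-- the diagonal, exactly one.  Such a path is determined by its word, and every
-- word of length n occurs, so the components correspond to the 2 ^ n words.
module Submission where

open import Defs
open import Data.Nat using (ℕ; _≥_; _^_)
open import Data.Fin using (Fin)
open import Function.Bundles using (Bijection)
open import Relation.Binary.PropositionalEquality using (setoid)

open import Axiom.UniquenessOfIdentityProofs using (module Decidable⇒UIP)
open import Data.Fin using (zero; suc; combine)
open import Data.Fin.Properties using (combine-injective; combine-surjective)
open import Data.Integer as ℤ using (0ℤ; 1ℤ)
import Data.Integer.Properties as ℤ
open import Data.List using (List; []; _∷_; _++_; length)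
open import Data.List.Properties using (∷-injectiveˡ)
open import Data.List.Relation.Unary.All as All using (All; []; _∷_)
open import Data.Nat using (zero; suc; _+_; _*_; _<_; s≤s; s<s; z<s)
open import Data.Nat.Properties
  using (+-identityʳ; +-suc; *-cancelˡ-≡; suc-injective; ≡-irrelevant; <-irrefl;
         ≤-<-trans; <-≤-trans; ≤-reflexive; m<n⇒m<1+n)
open import Data.Product using (_×_; _,_; ∃-syntax; proj₁)
open import Data.Vec as Vec using (Vec; []; _∷_; toList; fromList)
open import Data.Vec.Properties
  using (toList-injective; toList-cast; toList∘fromList; length-toList; cast-is-id)
open import Relation.Binary.Bundles using (Setoid)
import Relation.Binary.Construct.Closure.Equivalence as EqClosure
open import Relation.Binary.Construct.Closure.ReflexiveTransitive using (ε; _◅_)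
open import Relation.Binary.PropositionalEquality
  using (_≡_; _≢_; refl; sym; trans; cong; cong₂; subst; subst₂; isEquivalence;
         module ≡-Reasoning)
open import Relation.Nullary using (¬_; contradiction)

-- The word of a path and its invariance

-- The letter 0 stands for N and the letter 1 for D.
Word : Set
Word = List (Fin 2)

word : List Step → Word
word []       = []
word (N ∷ ss) = zero ∷ word ss
word (D ∷ ss) = suc zero ∷ word ss
word (E ∷ ss) = word ss

word-prepend : ∀ p {a b} → word a ≡ word b → word (p ++ a) ≡ word (p ++ b)
word-prepend []      eq = eq
word-prepend (N ∷ p) eq = cong (zero ∷_) (word-prepend p eq)
word-prepend (D ∷ p) eq = cong (suc zero ∷_) (word-prepend p eq)
word-prepend (E ∷ p) eq = word-prepend p eq

word-insert : ∀ u t → word (u ++ E ∷ t) ≡ word (u ++ t)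
word-insert u t = word-prepend u refl

⊲⇒word≡ : ∀ {n} {P Q : 𝒮 n} → P ⊲ Q → word (steps P) ≡ word (steps Q)
⊲⇒word≡ {P = P} {Q} c = begin
  word (steps P)                          ≡⟨ cong word P-steps ⟩
  word (before ++ E ∷ subpath ++ after)   ≡⟨ word-prepend before (word-insert subpath after) ⟨
  word (before ++ subpath ++ E ∷ after)   ≡⟨ cong word Q-steps ⟨
  word (steps Q)                          ∎
  where
  open _⊲_ c
  open ≡-Reasoning

≤ₛ⇒word≡ : ∀ {n} {P Q : 𝒮 n} → P ≤ₛ Q → word (steps P) ≡ word (steps Q)
≤ₛ⇒word≡ ε        = refl
≤ₛ⇒word≡ (c ◅ cs) = trans (⊲⇒word≡ c) (≤ₛ⇒word≡ cs)

-- Coordinates, length and equality of paths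

horiz : List Step → ℕ
horiz []       = 0
horiz (N ∷ ss) = horiz ss
horiz (E ∷ ss) = suc (horiz ss)
horiz (D ∷ ss) = suc (horiz ss)

-- N and D are the steps that raise the ordinate, so the ascent is the length of the word.
vert : List Step → ℕ
vert ss = length (word ss)

endpoint≡ : ∀ x y ss → endpoint (ℤ.+ x , ℤ.+ y) ss ≡ (ℤ.+ (horiz ss + x) , ℤ.+ (vert ss + y))
endpoint≡ x y []       = refl
endpoint≡ x y (N ∷ ss) = trans (endpoint≡ x (suc y) ss)
  (cong (λ z → ℤ.+ (horiz ss + x) , ℤ.+ z) (+-suc (vert ss) y))
endpoint≡ x y (E ∷ ss) = trans (endpoint≡ (suc x) y ss)
  (cong (λ z → ℤ.+ z , ℤ.+ (vert ss + y)) (+-suc (horiz ss) x))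
endpoint≡ x y (D ∷ ss) = trans (endpoint≡ (suc x) (suc y) ss)
  (cong₂ (λ z w → ℤ.+ z , ℤ.+ w) (+-suc (horiz ss) x) (+-suc (vert ss) y))

pathLength≡ : ∀ ss → pathLength ss ≡ horiz ss + vert ss
pathLength≡ []       = refl
pathLength≡ (N ∷ ss) = trans (cong suc (pathLength≡ ss)) (sym (+-suc (horiz ss) (vert ss)))
pathLength≡ (E ∷ ss) = cong suc (pathLength≡ ss)
pathLength≡ (D ∷ ss) =
  cong suc (trans (cong suc (pathLength≡ ss)) (sym (+-suc (horiz ss) (vert ss))))

horiz≡vert : ∀ {ss} → IsSchröderPath ss → horiz ss ≡ vert ss
horiz≡vert {ss} s = begin
  horiz ss      ≡⟨ +-identityʳ _ ⟨
  horiz ss + 0  ≡⟨ ℤ.+-injective (subst OnDiagonal (endpoint≡ 0 0 ss) endsOnDiagonal) ⟨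
  vert ss + 0   ≡⟨ +-identityʳ _ ⟩
  vert ss       ∎
  where
  open IsSchröderPath s
  open ≡-Reasoning

-- The length is the sum of the two displacements, which agree for a path ending on the diagonal.
-- Hence the word has `n` letters.
vert≡n : ∀ {n} (P : 𝒮 n) → vert (steps P) ≡ n
vert≡n {n} P = *-cancelˡ-≡ _ _ 2 (begin
  v + (v + 0)  ≡⟨ cong (v +_) (+-identityʳ v) ⟩
  v + v        ≡⟨ cong (_+ v) (horiz≡vert (isSchröder P)) ⟨
  horiz (steps P) + v  ≡⟨ pathLength≡ (steps P) ⟨
  pathLength (steps P) ≡⟨ length≡2n P ⟩
  2 * n        ∎)
  where
  v = vert (steps P)
  open ≡-Reasoning

¬startsWithE : ∀ {ss} → ¬ IsSchröderPath (E ∷ ss)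
¬startsWithE {ss} s with IsSchröderPath.staysAbove s
-- Splitting on the tail only makes `points` unfold; the point (1,0) would require 1 ≤ 0.
¬startsWithE {[]}    s | _ ∷ (ℤ.+≤+ ()) ∷ _
¬startsWithE {_ ∷ _} s | _ ∷ (ℤ.+≤+ ()) ∷ _

-- The `nonEmpty` fields agree definitionally, being functions into the empty type; the others are
-- an integer equation and a list of integer inequalities.
IsSchröderPath-irrelevant : ∀ {ss} (p q : IsSchröderPath ss) → p ≡ q
IsSchröderPath-irrelevant
  record { endsOnDiagonal = e ; staysAbove = a }
  record { endsOnDiagonal = e′ ; staysAbove = a′ }
  with refl ← Decidable⇒UIP.≡-irrelevant ℤ._≟_ e e′
     | refl ← All.irrelevant ℤ.≤-irrelevant a a′ = refl

steps-injective : ∀ {n} {P Q : 𝒮 n} → steps P ≡ steps Q → P ≡ Q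
steps-injective {P = record { isSchröder = s ; length≡2n = l }}
                {Q = record { isSchröder = s′ ; length≡2n = l′ }} refl
  with refl ← IsSchröderPath-irrelevant s s′
     | refl ← ≡-irrelevant l l′ = refl

-- Inverse covering steps and Hasse edges

-- These are the sub-paths from a valley to its first return that contain just one N or D step.
data Liftable : List Step → Set where
  lift-D  : Liftable (D ∷ [])
  lift-NE : Liftable (N ∷ E ∷ [])

Liftable⇒StartsWithNorD : ∀ {u} → Liftable u → StartsWithNorD u
Liftable⇒StartsWithNorD lift-D  = startsD
Liftable⇒StartsWithNorD lift-NE = startsN

[1+y]-[1+x]≡y-x : ∀ x y → (1ℤ ℤ.+ y) ℤ.- (1ℤ ℤ.+ x) ≡ y ℤ.- x
[1+y]-[1+x]≡y-x x y = begin
  (1ℤ ℤ.+ y) ℤ.- (1ℤ ℤ.+ x)         ≡⟨ cong (λ z → (1ℤ ℤ.+ y) ℤ.+ z) (ℤ.neg-distrib-+ 1ℤ x) ⟩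
  (1ℤ ℤ.+ y) ℤ.+ (ℤ.- 1ℤ ℤ.- x)     ≡⟨ cong (ℤ._+ (ℤ.- 1ℤ ℤ.- x)) (ℤ.+-comm 1ℤ y) ⟩
  (y ℤ.+ 1ℤ) ℤ.+ (ℤ.- 1ℤ ℤ.- x)     ≡⟨ ℤ.+-assoc y 1ℤ _ ⟩
  y ℤ.+ (1ℤ ℤ.+ (ℤ.- 1ℤ ℤ.- x))     ≡⟨ cong (λ z → y ℤ.+ z) (ℤ.+-assoc 1ℤ (ℤ.- 1ℤ) (ℤ.- x)) ⟨
  y ℤ.+ (0ℤ ℤ.- x)                  ≡⟨ cong (λ z → y ℤ.+ z) (ℤ.+-identityˡ (ℤ.- x)) ⟩
  y ℤ.- x                           ∎
  where open ≡-Reasoning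

[1+y]-x≢y-x : ∀ x y → (1ℤ ℤ.+ y) ℤ.- x ≢ y ℤ.- x
[1+y]-x≢y-x x y eq = ℤ.i≢suc[i] (sym (trans (sym (ℤ.+-assoc 1ℤ y (ℤ.- x))) eq))

Liftable⇒FirstReturn : ∀ {u} v → Liftable u → FirstReturn v u
Liftable⇒FirstReturn (x , y) lift-D = record
  { returns     = [1+y]-[1+x]≡y-x x y
  ; noneEarlier = λ where
      []            _ ne _  _    → contradiction refl ne
      (_ ∷ [])      _ _  ne refl → contradiction refl ne
      (_ ∷ _ ∷ _)   _ _  _  ()
  }
Liftable⇒FirstReturn (x , y) lift-NE = record
  { returns     = [1+y]-[1+x]≡y-x x y
  ; noneEarlier = λ where
      []              _ ne _  _    → contradiction refl ne
      (_ ∷ [])        _ _  _  refl → [1+y]-x≢y-x x y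
      (_ ∷ _ ∷ [])    _ _  ne refl → contradiction refl ne
      (_ ∷ _ ∷ _ ∷ _) _ _  _  ()
  }

-- Moving E behind `u` creates one new pair for `rank`: that E with the only N or D step of `u`.
rank-swap : ∀ pre {u} post → Liftable u →
            rank (pre ++ u ++ E ∷ post) ≡ suc (rank (pre ++ E ∷ u ++ post))
rank-swap []        post lift-D  = refl
rank-swap []        post lift-NE = refl
rank-swap (E ∷ pre) post l       = rank-swap pre post l
rank-swap (N ∷ pre) {u} post l   = trans
  (cong₂ _+_ (#E-prepend pre (#E-insert u post)) (rank-swap pre post l))
  (+-suc (#E (pre ++ E ∷ u ++ post)) _)
rank-swap (D ∷ pre) {u} post l   = trans
  (cong₂ _+_ (#E-prepend pre (#E-insert u post)) (rank-swap pre post l))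
  (+-suc (#E (pre ++ E ∷ u ++ post)) _)

pathLength-swap : ∀ pre {u} post → Liftable u →
                  pathLength (pre ++ E ∷ u ++ post) ≡ pathLength (pre ++ u ++ E ∷ post)
pathLength-swap []        post lift-D  = refl
pathLength-swap []        post lift-NE = refl
pathLength-swap (s ∷ pre) post l       = cong (stepLength s +_) (pathLength-swap pre post l)

endpoint-swap : ∀ p pre {u} post → Liftable u →
                endpoint p (pre ++ E ∷ u ++ post) ≡ endpoint p (pre ++ u ++ E ∷ post)
endpoint-swap p []        post lift-D  = refl
endpoint-swap p []        post lift-NE = refl
endpoint-swap p (s ∷ pre) post l       = endpoint-swap (move p s) pre post l

All-points-head : ∀ {P : Point → Set} p ss → All P (points p ss) → P p
All-points-head p []      (a ∷ _) = a
All-points-head p (_ ∷ _) (a ∷ _) = a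

1+-cancel-≤ : ∀ {x y} → 1ℤ ℤ.+ x ℤ.≤ 1ℤ ℤ.+ y → x ℤ.≤ y
1+-cancel-≤ {x} {y} h = subst₂ ℤ._≤_ (ℤ.pred-suc x) (ℤ.pred-suc y) (ℤ.pred-mono h)

-- The only new point is the valley. Its translate by (1,1) is the point where both paths meet
-- again, which lies on the given path; hence the valley is weakly above the diagonal.
staysAbove-swap : ∀ p pre {u} post → Liftable u →
                  All WeaklyAboveDiagonal (points p (pre ++ u ++ E ∷ post)) →
                  All WeaklyAboveDiagonal (points p (pre ++ E ∷ u ++ post))
staysAbove-swap p [] post lift-D (a ∷ _ ∷ as) =
  a ∷ 1+-cancel-≤ (All-points-head _ post as) ∷ as
staysAbove-swap p [] post lift-NE (a ∷ _ ∷ b ∷ as) =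
  a ∷ 1+-cancel-≤ (All-points-head _ post as) ∷ b ∷ as
staysAbove-swap p (s ∷ pre) post l (a ∷ as) = a ∷ staysAbove-swap (move p s) pre post l as

prepend-∷≢[] : ∀ (pre : List Step) {s post} → pre ++ s ∷ post ≢ []
prepend-∷≢[] []      ()
prepend-∷≢[] (_ ∷ _) ()

module Lower {n} (P : 𝒮 n) (pre : List Step) {u : List Step} (post : List Step)
             (liftable : Liftable u) (P-steps : steps P ≡ pre ++ u ++ E ∷ post) where

  lowered : 𝒮 n
  lowered = record
    { steps      = pre ++ E ∷ u ++ post
    ; isSchröder = record
      { nonEmpty       = prepend-∷≢[] pre
      ; endsOnDiagonal = subst OnDiagonal (sym (endpoint-swap origin pre post liftable))
          (subst (λ ss → OnDiagonal (endpoint origin ss)) P-steps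
            (IsSchröderPath.endsOnDiagonal (isSchröder P)))
      ; staysAbove     = staysAbove-swap origin pre post liftable
          (subst (λ ss → All WeaklyAboveDiagonal (points origin ss)) P-steps
            (IsSchröderPath.staysAbove (isSchröder P)))
      }
    ; length≡2n  = trans (pathLength-swap pre post liftable)
        (trans (cong pathLength (sym P-steps)) (length≡2n P))
    }

  lowered-⊲ : lowered ⊲ P
  lowered-⊲ = record
    { before      = pre
    ; subpath     = u
    ; after       = post
    ; P-steps     = refl
    ; valley      = Liftable⇒StartsWithNorD liftable
    ; firstReturn = Liftable⇒FirstReturn _ liftable
    ; Q-steps     = P-steps
    }

  rank-lowered : rank (steps P) ≡ suc (rank (steps lowered))
  rank-lowered = trans (cong rank P-steps) (rank-swap pre post liftable)

≺⇒rank< : ∀ {n} {P Q : 𝒮 n} → P ≤ₛ Q → P ≢ Q → rank (steps P) < rank (steps Q)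
≺⇒rank< ε        P≢Q = contradiction refl P≢Q
≺⇒rank< (c ◅ cs) _   = <-≤-trans (⊲⇒rank< c) (≤ₛ⇒rank≤ cs)

-- An element strictly between `P` and `Q` would force the rank to grow by at least two.
⊲∧rank≡⇒HasseEdge : ∀ {n} {P Q : 𝒮 n} → P ⊲ Q → rank (steps Q) ≡ suc (rank (steps P)) →
                    HasseEdge (𝒮-poset n) P Q
⊲∧rank≡⇒HasseEdge c eq =
  (c ◅ ε , λ { refl → <-irrefl refl (⊲⇒rank< c) }) ,
  λ { (_ , (P≤Z , P≢Z) , (Z≤Q , Z≢Q)) →
      <-irrefl refl (<-≤-trans (≤-<-trans (≺⇒rank< P≤Z P≢Z) (≺⇒rank< Z≤Q Z≢Q))
                               (≤-reflexive eq)) }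

-- Lowest paths and the classification of step sequences

canonical : Word → List Step
canonical []             = []
canonical (zero ∷ w)     = N ∷ E ∷ canonical w
canonical (suc zero ∷ w) = D ∷ canonical w

word-canonical : ∀ w → word (canonical w) ≡ w
word-canonical []             = refl
word-canonical (zero ∷ w)     = cong (zero ∷_) (word-canonical w)
word-canonical (suc zero ∷ w) = cong (suc zero ∷_) (word-canonical w)

horiz-canonical : ∀ w → horiz (canonical w) ≡ length w
horiz-canonical []             = refl
horiz-canonical (zero ∷ w)     = cong suc (horiz-canonical w)
horiz-canonical (suc zero ∷ w) = cong suc (horiz-canonical w)

vert-canonical : ∀ w → vert (canonical w) ≡ length w
vert-canonical w = cong length (word-canonical w)

-- An arbitrary diagonal starting point makes the induction go through: each factor NE or D leads to
-- the next one.
staysAbove-canonical : ∀ i w → All WeaklyAboveDiagonal (points (i , i) (canonical w))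
staysAbove-canonical i []             = ℤ.≤-refl ∷ []
staysAbove-canonical i (zero ∷ w)     =
  ℤ.≤-refl ∷ ℤ.i≤suc[i] i ∷ staysAbove-canonical (1ℤ ℤ.+ i) w
staysAbove-canonical i (suc zero ∷ w) = ℤ.≤-refl ∷ staysAbove-canonical (1ℤ ℤ.+ i) w

endsOnDiagonal-canonical : ∀ i w → OnDiagonal (endpoint (i , i) (canonical w))
endsOnDiagonal-canonical i []             = refl
endsOnDiagonal-canonical i (zero ∷ w)     = endsOnDiagonal-canonical (1ℤ ℤ.+ i) w
endsOnDiagonal-canonical i (suc zero ∷ w) = endsOnDiagonal-canonical (1ℤ ℤ.+ i) w

canonical≢[] : ∀ {w} → w ≢ [] → canonical w ≢ []
canonical≢[] {[]}           w≢[] _ = w≢[] refl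
canonical≢[] {zero ∷ w}     _ ()
canonical≢[] {suc zero ∷ w} _ ()

canonicalPath : ∀ {n} w → w ≢ [] → length w ≡ n → 𝒮 n
canonicalPath {n} w w≢[] eq = record
  { steps      = canonical w
  ; isSchröder = record
    { nonEmpty       = canonical≢[] w≢[]
    ; endsOnDiagonal = endsOnDiagonal-canonical 0ℤ w
    ; staysAbove     = staysAbove-canonical 0ℤ w
    }
  ; length≡2n  = begin
      pathLength (canonical w)                      ≡⟨ pathLength≡ (canonical w) ⟩
      horiz (canonical w) + vert (canonical w)      ≡⟨ cong₂ _+_ (horiz-canonical w) (vert-canonical w) ⟩
      length w + length w                           ≡⟨ cong (length w +_) (+-identityʳ (length w)) ⟨
      2 * length w                                  ≡⟨ cong (2 *_) eq ⟩
      2 * n                                         ∎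
  }
  where open ≡-Reasoning

-- Stated for all step sequences, since tails of a Schröder path need not be Schröder paths. For a
-- Schröder path, `leading-E` would go below the diagonal and `surplus` would end above it.
data Shape : List Step → Set where
  leading-E : ∀ {ss t} → ss ≡ E ∷ t → Shape ss
  lowerable : ∀ {ss} pre {u} post → Liftable u → ss ≡ pre ++ u ++ E ∷ post → Shape ss
  surplus   : ∀ {ss} → horiz ss < vert ss → Shape ss
  lowest    : ∀ {ss} w → ss ≡ canonical w → Shape ss

-- A canonical tail climbs as much as it advances, so an N in front of it that is not followed by E
-- remains unmatched.
Shape-N∷ : ∀ {s ss} → s ≢ E → Shape (s ∷ ss) → Shape (N ∷ s ∷ ss)
Shape-N∷ s≢E (leading-E eq)           = contradiction (∷-injectiveˡ eq) s≢E
Shape-N∷ _ (lowerable pre post l eq)  = lowerable (N ∷ pre) post l (cong (N ∷_) eq)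
Shape-N∷ _ (surplus lt)               = surplus (m<n⇒m<1+n lt)
Shape-N∷ {s} {ss} _ (lowest w eq)     = surplus (s≤s (≤-reflexive (begin
  horiz (s ∷ ss)       ≡⟨ cong horiz eq ⟩
  horiz (canonical w)  ≡⟨ horiz-canonical w ⟩
  length w             ≡⟨ vert-canonical w ⟨
  vert (canonical w)   ≡⟨ cong vert eq ⟨
  vert (s ∷ ss)        ∎)))
  where open ≡-Reasoning

-- The recursion strips a leading D or NE. If the remainder starts with E, that factor can be
-- lowered on the spot.
shape : ∀ ss → Shape ss
shape []           = lowest [] refl
shape (E ∷ ss)     = leading-E refl
shape (D ∷ ss) with shape ss
... | leading-E refl          = lowerable [] _ lift-D refl
... | lowerable pre post l eq = lowerable (D ∷ pre) post l (cong (D ∷_) eq)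
... | surplus lt              = surplus (s<s lt)
... | lowest w eq             = lowest (suc zero ∷ w) (cong (D ∷_) eq)
shape (N ∷ [])     = surplus z<s
shape (N ∷ E ∷ ss) with shape ss
... | leading-E refl          = lowerable [] _ lift-NE refl
... | lowerable pre post l eq = lowerable (N ∷ E ∷ pre) post l (cong (λ t → N ∷ E ∷ t) eq)
... | surplus lt              = surplus (s<s lt)
... | lowest w eq             = lowest (zero ∷ w) (cong (λ t → N ∷ E ∷ t) eq)
shape (N ∷ N ∷ ss) = Shape-N∷ (λ ()) (shape (N ∷ ss))
shape (N ∷ D ∷ ss) = Shape-N∷ (λ ()) (shape (D ∷ ss))

-- Components correspond to words

module _ {n : ℕ} where

  private module ~ = Setoid (components (𝒮-poset n))
  open ~ using () renaming (_≈_ to _~_)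

  ~⇒word≡ : ∀ {P Q : 𝒮 n} → P ~ Q → word (steps P) ≡ word (steps Q)
  ~⇒word≡ = EqClosure.gfold isEquivalence (λ P → word (steps P))
    (λ e → ≤ₛ⇒word≡ (proj₁ (proj₁ e)))

  -- Induction on the rank `k`, which drops by exactly one with each lowering; at rank 0 no lowering
  -- is possible.
  descend : ∀ k (P : 𝒮 n) → rank (steps P) ≡ k → ∃[ w ] ∃[ Q ] (P ~ Q × steps Q ≡ canonical w)
  descend k P rank≡k with shape (steps P)
  ... | leading-E eq = contradiction (subst IsSchröderPath eq (isSchröder P)) ¬startsWithE
  ... | surplus lt   = contradiction lt (<-irrefl (horiz≡vert (isSchröder P)))
  ... | lowest w eq  = w , P , ~.refl , eq
  descend zero P rank≡0 | lowerable pre post l eq =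
    contradiction (trans (sym (Lower.rank-lowered P pre post l eq)) rank≡0) λ ()
  descend (suc k) P rank≡1+k | lowerable pre post l eq =
    let w , Q , lowered~Q , eq′ =
          descend k lowered (suc-injective (trans (sym rank-lowered) rank≡1+k))
    in  w , Q , ~.trans (~.sym lowered~P) lowered~Q , eq′
    where
    open Lower P pre post l eq
    lowered~P : lowered ~ P
    lowered~P = EqClosure.return (⊲∧rank≡⇒HasseEdge lowered-⊲ rank-lowered)

  -- The word `w` found by `descend` must be that of `P`, because words are constant on components.
  ~canonical : (P : 𝒮 n) → ∃[ Q ] (P ~ Q × steps Q ≡ canonical (word (steps P)))
  ~canonical P =
    let w , Q , P~Q , eq = descend _ P refl
    in  Q , P~Q , trans eq (cong canonical (begin
          w                   ≡⟨ word-canonical w ⟨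
          word (canonical w)  ≡⟨ cong word eq ⟨
          word (steps Q)      ≡⟨ ~⇒word≡ P~Q ⟨
          word (steps P)      ∎))
    where open ≡-Reasoning

  word≡⇒~ : ∀ {P Q : 𝒮 n} → word (steps P) ≡ word (steps Q) → P ~ Q
  word≡⇒~ {P} {Q} eq with ~canonical P | ~canonical Q
  ... | P′ , P~P′ , eqP | Q′ , Q~Q′ , eqQ
    with refl ← steps-injective {P = P′} {Q = Q′} (trans eqP (trans (cong canonical eq) (sym eqQ)))
    = ~.trans P~P′ (~.sym Q~Q′)

  -- Fixing the length in the type makes the words a finite type. Equalities are checked after
  -- `toList`, which forgets the cast.
  letters : 𝒮 n → Vec (Fin 2) n
  letters P = Vec.cast (vert≡n P) (fromList (word (steps P)))

  toList-letters : ∀ P → toList (letters P) ≡ word (steps P)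
  toList-letters P = trans (toList-cast (vert≡n P) (fromList (word (steps P))))
                           (toList∘fromList (word (steps P)))

  letters-cong : ∀ {P Q} → P ~ Q → letters P ≡ letters Q
  letters-cong {P} {Q} P~Q = trans (sym (cast-is-id refl (letters P)))
    (toList-injective refl (letters P) (letters Q)
      (trans (toList-letters P) (trans (~⇒word≡ P~Q) (sym (toList-letters Q)))))

  letters-injective : ∀ {P Q} → letters P ≡ letters Q → P ~ Q
  letters-injective {P} {Q} eq = word≡⇒~
    (trans (sym (toList-letters P)) (trans (cong toList eq) (toList-letters Q)))

letters-surjective : ∀ {n} → n ≥ 1 → (v : Vec (Fin 2) n) → ∃[ P ] letters P ≡ v
-- Here `n ≥ 1` makes the vector non-empty, as `nonEmpty` demands of its canonical path.
letters-surjective (s≤s _) v@(_ ∷ _) = P , trans (sym (cast-is-id refl (letters P)))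
  (toList-injective refl (letters P) v
    (trans (toList-letters P) (word-canonical (toList v))))
  where P = canonicalPath (toList v) (λ ()) (length-toList v)

-- The binary value of the vector, first letter most significant.
code : ∀ {n} → Vec (Fin 2) n → Fin (2 ^ n)
code []      = zero
code (x ∷ v) = combine x (code v)

code-injective : ∀ {n} (v w : Vec (Fin 2) n) → code v ≡ code w → v ≡ w
code-injective []      []      _  = refl
code-injective (x ∷ v) (y ∷ w) eq =
  let x≡y , eq′ = combine-injective x (code v) y (code w) eq
  in  cong₂ _∷_ x≡y (code-injective v w eq′)

code-surjective : ∀ {n} (i : Fin (2 ^ n)) → ∃[ v ] code {n} v ≡ i
code-surjective {zero}  zero = [] , refl
code-surjective {suc n} i    =
  let x , j , eq  = combine-surjective {2} {2 ^ n} i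
      v , eq′     = code-surjective {n} j
  in  x ∷ v , trans (cong (combine x) eq′) eq

proposition5p1 : (n : ℕ) → n ≥ 1 → Bijection (components (𝒮-poset n)) (setoid (Fin (2 ^ n)))
proposition5p1 n n≥1 = record
  { to        = λ P → code (letters P)
  ; cong      = λ P~Q → cong code (letters-cong P~Q)
  ; bijective =
      (λ {P} {Q} eq → letters-injective (code-injective (letters P) (letters Q) eq))
    , λ i → let v , code-v≡i    = code-surjective {n} i
                P , letters-P≡v = letters-surjective n≥1 v
            -- Surjectivity between setoids concerns every path in the component of `P`.
            in  P , λ Q~P → trans (cong code (trans (letters-cong Q~P) letters-P≡v)) code-v≡i
  }
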